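{- Let $T$ be a tree, let $S_1 = (G_1, \sigma_1)$ be a signed graph, let $S_2 = (T, \sigma_2)$ be a signed graph with underlying graph $T$, and let $S = S_1 \times S_2$ be their tensor product. If $\chi'(S_1) = \Delta(S_1)$, then $\chi'(S) = \Delta(S)$.
   Context: All graphs are simple, finite and undirected. A signed graph is a pair $S=(G,\sigma)$ where $G$ is a graph and $\sigma\colon E(G)\to\{+1,-1\}$; $G$ is the underlying graph. $V(S)$, $E(S)$ and $\Delta(S)$ (maximum degree) refer to the underlying graph. An incidence is a pair $v\text{:}e$ of a vertex $v$ and an edge $e$ having $v$ as an endpoint; $I(G)$ is the set of all incidences. For a positive integer $k$ let $M_k=\{0,\pm1,\ldots,\pm l\}$ if $k=2l+1$ and $M_k=\{\pm1,\ldots,\pm l\}$ if $k=2l$. A $k$-edge-coloring of $S=(G,\sigma)$ is a function $f\colon I(G)\to M_k$ such that $f(u\text{:}uv)=-\sigma(uv)f(v\text{:}uv)$ for each edge $uv$, and $f(u\text{:}uv_1)\neq f(u\text{:}uv_2)$ for any two distinct edges $uv_1\neq uv_2$ at a common vertex $u$. The chromatic index $\chi'(S)$ is the smallest $k$ for which $S$ has a $k$-edge-coloring; a signed graph with no edges has chromatic index $0$. The tensor product $S_1\times S_2$ of signed graphs $S_1=(G_1,\sigma_1)$, $S_2=(G_2,\sigma_2)$ is the signed graph with vertex set $V(S_1)\times V(S_2)$ in which $(u,u')(v,v')$ is an edge iff $uv\in E(S_1)$ and $u'v'\in E(S_2)$; the sign of this edge is $\sigma_1(uv)\sigma_2(u'v')$.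 -}

module Defs where

open import Data.Fin.Base using (Fin)
open import Data.Fin.Properties using (*↔×)
open import Data.Integer.Base as ℤ using (ℤ; 0ℤ; ∣_∣; _◃_)
open import Data.List.Base using (List; _∷_; _∷ʳ_; map; filter; length; allFin)
open import Data.List.Extrema.Nat using (max)
open import Data.List.Relation.Unary.Linked using (Linked)
open import Data.List.Relation.Unary.Unique.Propositional using (Unique)
open import Data.Nat.Base as ℕ using (ℕ; _≤_)
open import Data.Product.Base using (_×_; _,_)
open import Data.Product.Function.NonDependent.Propositional using (_×-↔_)
open import Data.Sign.Base as Sign using (Sign)
open import Function.Bundles using (_↔_; Inverse)
open import Function.Construct.Composition using (_↔-∘_)
open import Level using (0ℓ)
open import Relation.Binary.Construct.Closure.ReflexiveTransitive using (Star)
open import Relation.Binary.Core using (Rel)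
open import Relation.Binary.Definitions using (Symmetric; Decidable; Irrelevant)
open import Relation.Binary.PropositionalEquality using (_≡_; _≢_; cong₂)
open import Relation.Nullary using (¬_)
open import Relation.Nullary.Decidable using (_×-dec_)
open import Relation.Unary using (Pred; _∈_)

record Graph : Set₁ where
  infix 4 _~_ _~?_
  field
    V            : Set
    order        : ℕ
    enum         : Fin order ↔ V
    _~_          : Rel V 0ℓ
    _~?_         : Decidable _~_
    -- A pair of vertices carries at most one edge, so that a function on
    -- proofs of u ~ v is a function on pairs of adjacent vertices.
    ~-irrelevant : Irrelevant _~_
    ~-sym        : Symmetric _~_
    ~-irrefl     : ∀ {v} → ¬ (v ~ v)

  vertices : List V
  vertices = map (Inverse.to enum) (allFin order)

  degree : V → ℕ
  degree v = length (filter (v ~?_) vertices)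

  maxDegree : ℕ
  maxDegree = max 0 (map degree vertices)

  Connected : Set
  Connected = V × (∀ u v → Star _~_ u v)

  -- The vertices of a cycle in order, listed once each; there are at
  -- least three of them.
  record Cycle : Set where
    field
      first second last : V
      others            : List V
    path : List V
    path = first ∷ second ∷ (others ∷ʳ last)
    field
      distinct : Unique path
      linked   : Linked _~_ path
      closed   : last ~ first

  IsTree : Set
  IsTree = Connected × ¬ Cycle

record Signature (G : Graph) : Set where
  open Graph G
  field
    σ     : ∀ {u v} → u ~ v → Sign
    σ-sym : ∀ {u v} (e : u ~ v) → σ (~-sym e) ≡ σ e

record SignedGraph : Set₁ where
  constructor _,_
  field
    graph     : Graph
    signature : Signature graph
  open Graph graph public
  open Signature signature public

Δ : SignedGraph → ℕ
Δ S = SignedGraph.maxDegree S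

-- M 0 is empty, so exactly the signed graphs without edges have a
-- 0-edge-coloring.
data M (k : ℕ) : Pred ℤ 0ℓ where
  odd  : ∀ {c} l → k ≡ 2 ℕ.* l ℕ.+ 1 → ∣ c ∣ ≤ l → M k c
  even : ∀ {c} l → k ≡ 2 ℕ.* l → ∣ c ∣ ≤ l → c ≢ 0ℤ → M k c

-- As graphs are simple, e : u ~ v represents the incidence u:uv, and
-- ~-sym e the incidence v:uv.
record EdgeColoring (S : SignedGraph) (k : ℕ) : Set where
  open SignedGraph S
  field
    f      : ∀ {u v} → u ~ v → ℤ
    f∈M    : ∀ {u v} (e : u ~ v) → f e ∈ M k
    signed : ∀ {u v} (e : u ~ v) → f e ≡ ℤ.- ((σ e ◃ 1) ℤ.* f (~-sym e))
    proper : ∀ {u v w} (d : u ~ v) (e : u ~ w) → v ≢ w → f d ≢ f e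

HasChromaticIndex : SignedGraph → ℕ → Set
HasChromaticIndex S k = EdgeColoring S k × (∀ j → EdgeColoring S j → k ≤ j)

infixr 7 _×ᴳ_ _×ˢ_

_×ᴳ_ : Graph → Graph → Graph
G₁ ×ᴳ G₂ = record
  { V            = G₁.V × G₂.V
  ; order        = G₁.order ℕ.* G₂.order
  ; enum         = (G₁.enum ×-↔ G₂.enum) ↔-∘ *↔×
  ; _~_          = λ { (u , u′) (v , v′) → u G₁.~ v × u′ G₂.~ v′ }
  ; _~?_         = λ { (u , u′) (v , v′) → (u G₁.~? v) ×-dec (u′ G₂.~? v′) }
  ; ~-irrelevant = λ { (d , d′) (e , e′) →
                       cong₂ _,_ (G₁.~-irrelevant d e) (G₂.~-irrelevant d′ e′) }
  ; ~-sym        = λ { (e , e′) → G₁.~-sym e , G₂.~-sym e′ }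
  ; ~-irrefl     = λ { (e , _) → G₁.~-irrefl e }
  }
  where
  module G₁ = Graph G₁
  module G₂ = Graph G₂

_×ˢ_ : SignedGraph → SignedGraph → SignedGraph
S₁ ×ˢ S₂ = S₁.graph ×ᴳ S₂.graph , record
  { σ     = λ { (e , e′) → S₁.σ e Sign.* S₂.σ e′ }
  ; σ-sym = λ { (e , e′) → cong₂ Sign._*_ (S₁.σ-sym e) (S₂.σ-sym e′) }
  }
  where
  module S₁ = SignedGraph S₁
  module S₂ = SignedGraph S₂

{-# OPTIONS --safe #-}
module Submission where

open import Defs

-- Let k = Δ(S₁), let D = Δ(T) and let f be a k-edge-coloring of S₁. Growing T
-- one vertex at a time, always attached by a single edge, yields a proper
-- edge coloring c with D colours of the unsigned tree and, as every
-- signature ρ of T is balanced, a switching function τ with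
-- ρ(uv) = τ(u) τ(v). At (u , u′) the edge (u , u′)(v , v′) receives
--   ± τ(u′) ((|f(u:uv)| − 1) D + c(u′v′) + offset + 1), with the sign of
--   f(u:uv) and with τ switching σ₂, if f(u:uv) ≠ 0, and
--   τ(u′) h(c(u′v′)), with h injective into M D and with τ switching
--   −σ₁(uv) σ₂, if f(u:uv) = 0.
-- This is a kD-edge-coloring. Both kD ≤ Δ(S) and Δ(S) ≤ χ′(S) are counting.

open import Data.Fin.Base using (Fin; zero; suc; fromℕ<)
open import Data.Fin.Properties using (injective⇒≤; inj⇒≟; fromℕ<-injective)
open import Data.Integer.Base as ℤ using (ℤ; +_; -[1+_]; +0; +[1+_]; 0ℤ; ∣_∣; _◃_)
import Data.Integer.Properties as ℤ
open import Data.List.Base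
  using (List; []; _∷_; [_]; _∷ʳ_; map; filter; length; lookup; allFin; upTo; cartesianProduct)
open import Data.List.Extrema.Nat using (max≤v⁺; xs≤max; argmax-sel)
open import Data.List.Membership.Propositional using (_∈_; _∉_; find)
import Data.List.Membership.DecPropositional as DecMembership
open import Data.List.Membership.Propositional.Properties
  using (∈-map⁺; ∈-map⁻; ∈-filter⁺; ∈-filter⁻; ∈-allFin; ∈-lookup; ∈-upTo⁻; ∈-cartesianProduct⁻)
open import Data.List.Membership.Setoid.Properties using (index-injective)
open import Data.List.Properties using (filter-notAll; length-map; length-upTo; length-++)
open import Data.List.Relation.Binary.Subset.Propositional using (_⊆_)
open import Data.List.Relation.Unary.All as All using (All; []; _∷_; all?)
import Data.List.Relation.Unary.All.Properties as All
open import Data.List.Relation.Unary.AllPairs using ([]; _∷_)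
open import Data.List.Relation.Unary.Any as Any using (here; there; index)
open import Data.List.Relation.Unary.Linked using (Linked; [-]; _∷_)
open import Data.List.Relation.Unary.Unique.Propositional using (Unique)
import Data.List.Relation.Unary.Unique.Propositional.Properties as Unique
open import Data.Nat.Base hiding (parity; ∣_-_∣)
open import Data.Nat.DivMod using (_%_; [m+kn]%n≡m%n; m<n⇒m%n≡m)
open import Data.Nat.Properties
open import Data.Nat.Tactic.RingSolver using (solve-∀)
open import Data.Product.Base using (∃; _×_; _,_; proj₁; proj₂)
open import Data.Sign.Base as Sign using (Sign; opposite)
import Data.Sign.Properties as Sign
open import Data.Sum.Base using (_⊎_; inj₁; inj₂; [_,_]′)
open import Function.Base using (_∘_; case_of_)
open import Function.Bundles using (Inverse; Injection)
open import Function.Construct.Symmetry using (↔-sym)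
open import Function.Properties.Inverse using (↔⇒↣)
open import Level using (0ℓ)
open import Relation.Binary.Construct.Closure.ReflexiveTransitive using (Star; ε; _◅_)
open import Relation.Binary.Core using (Rel)
open import Relation.Binary.Definitions using (DecidableEquality)
open import Relation.Binary.PropositionalEquality hiding ([_])
open import Relation.Nullary using (¬_; yes; no; contradiction)

-- Counting with duplicate-free lists, and degrees in graphs and products.

lookup-injective : ∀ {A : Set} {xs : List A} → Unique xs →
                   ∀ i j → lookup xs i ≡ lookup xs j → i ≡ j
lookup-injective (_  ∷ _) zero    zero    _  = refl
lookup-injective (px ∷ _) zero    (suc j) eq = contradiction eq (All.lookup px (∈-lookup j))
lookup-injective (px ∷ _) (suc i) zero    eq = contradiction (sym eq) (All.lookup px (∈-lookup i))
lookup-injective (_  ∷ u) (suc i) (suc j) eq = cong suc (lookup-injective u i j eq)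

injection⇒length≤ : ∀ {A : Set} {xs : List A} {n} → Unique xs →
                    (f : ∀ {x} → x ∈ xs → Fin n) →
                    (∀ {x y} (p : x ∈ xs) (q : y ∈ xs) → f p ≡ f q → x ≡ y) →
                    length xs ≤ n
injection⇒length≤ u f f-injective =
  injective⇒≤ {f = f ∘ ∈-lookup}
    λ {i} {j} eq → lookup-injective u i j (f-injective (∈-lookup i) (∈-lookup j) eq)

Unique∧⊆⇒length≤ : ∀ {A : Set} {xs ys : List A} → Unique xs → xs ⊆ ys →
                   length xs ≤ length ys
Unique∧⊆⇒length≤ u xs⊆ys = injection⇒length≤ u (index ∘ xs⊆ys)
  λ p q → index-injective (setoid _) (xs⊆ys p) (xs⊆ys q)

length-cartesianProduct : ∀ {A B : Set} (xs : List A) (ys : List B) →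
                          length (cartesianProduct xs ys) ≡ length xs * length ys
length-cartesianProduct []       ys = refl
length-cartesianProduct (x ∷ xs) ys = trans
  (length-++ (map (x ,_) ys))
  (cong₂ _+_ (length-map (x ,_) ys) (length-cartesianProduct xs ys))

-- Pigeonhole: if `xs` contained all of `upTo n`, it would have at least n entries. It supplies the
-- free colour for a newly attached tree edge.
fresh : ∀ n (xs : List ℕ) → length xs < n → ∃ λ i → i < n × i ∉ xs
fresh n xs len<n with all? (_∈? xs) (upTo n)
  where open DecMembership _≟_ using (_∈?_)
... | yes upTo⊆xs = contradiction
  (subst (_≤ length xs) (length-upTo n) (Unique∧⊆⇒length≤ (Unique.upTo⁺ n) (All.lookup upTo⊆xs)))
  (<⇒≱ len<n)
... | no ¬upTo⊆xs with find (All.¬All⇒Any¬ (_∈? xs) (upTo n) ¬upTo⊆xs)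
  where open DecMembership _≟_ using (_∈?_)
... | i , i∈upTo , i∉xs = i , ∈-upTo⁻ i∈upTo , i∉xs

module GraphProperties (G : Graph) where
  open Graph G
  open Inverse enum using (to; from; strictlyInverseˡ)

  infix 4 _≟ⱽ_
  _≟ⱽ_ : DecidableEquality V
  _≟ⱽ_ = inj⇒≟ (↔⇒↣ (↔-sym enum))

  ∈-vertices : ∀ v → v ∈ vertices
  ∈-vertices v = subst (_∈ vertices) (strictlyInverseˡ v) (∈-map⁺ to (∈-allFin (from v)))

  neighbours : V → List V
  neighbours v = filter (v ~?_) vertices

  ∈-neighbours⁺ : ∀ {v w} → v ~ w → w ∈ neighbours v
  ∈-neighbours⁺ {v} {w} = ∈-filter⁺ (v ~?_) (∈-vertices w)

  ∈-neighbours⁻ : ∀ {v w} → w ∈ neighbours v → v ~ w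
  ∈-neighbours⁻ {v} = proj₂ ∘ ∈-filter⁻ (v ~?_) {xs = vertices}

  neighbours-unique : ∀ v → Unique (neighbours v)
  neighbours-unique v = Unique.filter⁺ (v ~?_)
    (Unique.map⁺ (Injection.injective (↔⇒↣ enum)) (Unique.allFin⁺ order))

  degree≤maxDegree : ∀ v → degree v ≤ maxDegree
  degree≤maxDegree v = All.lookup (xs≤max 0 (map degree vertices)) (∈-map⁺ degree (∈-vertices v))

  maxDegree≤ : ∀ {n} → (∀ v → degree v ≤ n) → maxDegree ≤ n
  maxDegree≤ bound = max≤v⁺ z≤n (All.map⁺ {xs = vertices} (All.tabulate λ {v} _ → bound v))

  maxDegree-sel : maxDegree ≡ 0 ⊎ ∃ λ v → maxDegree ≡ degree v
  maxDegree-sel with argmax-sel (λ n → n) 0 (map degree vertices)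
  ... | inj₁ eq = inj₁ eq
  ... | inj₂ max∈ with v , _ , eq ← ∈-map⁻ degree max∈ = inj₂ (v , eq)

-- If u and v attain the two maximum degrees, all pairs of a neighbour of u and a neighbour of v are
-- distinct neighbours of (u , v).
maxDegree-×ᴳ : ∀ G H → Graph.maxDegree G * Graph.maxDegree H ≤ Graph.maxDegree (G ×ᴳ H)
maxDegree-×ᴳ G H with GraphProperties.maxDegree-sel G | GraphProperties.maxDegree-sel H
... | inj₁ eq | _ rewrite eq = z≤n
... | inj₂ _ | inj₁ eq rewrite eq | *-zeroʳ (Graph.maxDegree G) = z≤n
... | inj₂ (u , equ) | inj₂ (v , eqv) = begin
  Graph.maxDegree G * Graph.maxDegree H  ≡⟨ cong₂ _*_ equ eqv ⟩
  Graph.degree G u * Graph.degree H v    ≡⟨ length-cartesianProduct (G.neighbours u) (H.neighbours v) ⟨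
  length (cartesianProduct (G.neighbours u) (H.neighbours v))
    ≤⟨ Unique∧⊆⇒length≤
         (Unique.cartesianProduct⁺ (G.neighbours-unique u) (H.neighbours-unique v))
         (λ p → GH.∈-neighbours⁺ (adjacent (∈-cartesianProduct⁻ (G.neighbours u) (H.neighbours v) p))) ⟩
  Graph.degree (G ×ᴳ H) (u , v)          ≤⟨ GH.degree≤maxDegree (u , v) ⟩
  Graph.maxDegree (G ×ᴳ H)               ∎
  where
  open ≤-Reasoning
  module G = GraphProperties G
  module H = GraphProperties H
  module GH = GraphProperties (G ×ᴳ H)
  adjacent : ∀ {x y} → x ∈ G.neighbours u × y ∈ H.neighbours v →
             Graph._~_ G u x × Graph._~_ H v y
  adjacent (p , q) = G.∈-neighbours⁻ p , H.∈-neighbours⁻ q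

-- Switchings and edge colourings of trees

Unique-∷ʳ⁺ : ∀ {A : Set} {x : A} {xs} → Unique xs → x ∉ xs → Unique (xs ∷ʳ x)
Unique-∷ʳ⁺ u x∉xs = Unique.++⁺ u ([] ∷ []) λ { (x∈xs , here refl) → x∉xs x∈xs }

Linked-∷ʳ⁺ : ∀ {A : Set} {R : Rel A 0ℓ} {x y} (xs : List A) →
             Linked R (xs ∷ʳ x) → R x y → Linked R (xs ∷ʳ x ∷ʳ y)
Linked-∷ʳ⁺ []           [-]      r = r ∷ [-]
Linked-∷ʳ⁺ (_ ∷ [])     (s ∷ l) r = s ∷ Linked-∷ʳ⁺ [] l r
Linked-∷ʳ⁺ (_ ∷ y ∷ xs) (s ∷ l) r = s ∷ Linked-∷ʳ⁺ (y ∷ xs) l r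

module Acyclic (G : Graph) (acyclic : ¬ Graph.Cycle G) where
  open Graph G
  open GraphProperties G
  open DecMembership _≟ⱽ_ using (_∈?_)

  -- The ends stand apart from `inner`, so that a path with a nonempty `inner` has literally the
  -- shape of `path` in `Cycle`. Confinement to `L` lets a vertex outside `L` be attached at either
  -- end without repetition.
  record SimplePath (L : List V) (p q : V) : Set where
    field
      inner  : List V
      unique : Unique (p ∷ inner ∷ʳ q)
      linked : Linked _~_ (p ∷ inner ∷ʳ q)
      inside : All (_∈ L) (p ∷ inner ∷ʳ q)

  open SimplePath

  PathConnected : List V → Set
  PathConnected L = ∀ {p q} → p ∈ L → q ∈ L → p ≢ q → SimplePath L p q

  edge : ∀ {L p q} → p ∈ L → q ∈ L → p ~ q → SimplePath L p q
  edge p∈L q∈L p~q = record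
    { inner  = []
    ; unique = ((λ { refl → ~-irrefl p~q }) ∷ []) ∷ [] ∷ []
    ; linked = p~q ∷ [-]
    ; inside = p∈L ∷ q∈L ∷ []
    }

  extendˡ : ∀ {L w p q} → w ∉ L → w ~ p → SimplePath L p q → SimplePath (w ∷ L) w q
  extendˡ {p = p} w∉L w~p π = record
    { inner  = p ∷ inner π
    ; unique = All.map (λ { x∈L refl → w∉L x∈L }) (inside π) ∷ unique π
    ; linked = w~p ∷ linked π
    ; inside = here refl ∷ All.map there (inside π)
    }

  extendʳ : ∀ {L w p q} → w ∉ L → p ~ w → SimplePath L q p → SimplePath (w ∷ L) q w
  extendʳ {p = p} {q} w∉L p~w π = record
    { inner  = inner π ∷ʳ p
    ; unique = Unique-∷ʳ⁺ (unique π) (w∉L ∘ All.lookup (inside π))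
    ; linked = Linked-∷ʳ⁺ (q ∷ inner π) (linked π) p~w
    ; inside = All.∷ʳ⁺ (All.map there (inside π)) (here refl)
    }

  weaken : ∀ {L w p q} → SimplePath L p q → SimplePath (w ∷ L) p q
  weaken π = record
    { inner = inner π ; unique = unique π ; linked = linked π ; inside = All.map there (inside π) }

  PathConnected-∷ : ∀ {L p w} → PathConnected L → p ∈ L → w ∉ L → p ~ w → PathConnected (w ∷ L)
  PathConnected-∷ conn p∈L w∉L p~w (here refl) (here refl) x≢y = contradiction refl x≢y
  PathConnected-∷ {p = p} conn p∈L w∉L p~w {q = q} (here refl) (there q∈L) _ with p ≟ⱽ q
  ... | yes refl = edge (here refl) (there p∈L) (~-sym p~w)
  ... | no p≢q   = extendˡ w∉L (~-sym p~w) (conn p∈L q∈L p≢q)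
  PathConnected-∷ {p = p} conn p∈L w∉L p~w {p = q} (there q∈L) (here refl) _ with q ≟ⱽ p
  ... | yes refl = edge (there p∈L) (here refl) p~w
  ... | no q≢p   = extendʳ w∉L p~w (conn q∈L p∈L q≢p)
  PathConnected-∷ conn _ _ _ (there x∈L) (there y∈L) x≢y = weaken (conn x∈L y∈L x≢y)

  -- Two neighbours of w in a path-connected set avoiding w would close a
  -- cycle through w.
  unique-neighbour : ∀ {L p q w} → PathConnected L → w ∉ L →
                     p ∈ L → p ~ w → q ∈ L → q ~ w → q ≡ p
  unique-neighbour {p = p} {q} {w} conn w∉L p∈L p~w q∈L q~w with q ≟ⱽ p
  ... | yes q≡p = q≡p
  ... | no q≢p  = contradiction cycle acyclic
    where
    π : SimplePath (w ∷ _) w q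
    π = extendˡ w∉L (~-sym p~w) (conn p∈L q∈L (q≢p ∘ sym))
    cycle : Cycle
    cycle = record { distinct = unique π ; linked = linked π ; closed = q~w }

  module _
    (P : List V → Set)
    (P-∷ : ∀ {L p w} → p ∈ L → w ∉ L → p ~ w →
           (∀ {q} → q ∈ L → q ~ w → q ≡ p) → P L → P (w ∷ L))
    where

    Built : List V → Set
    Built L = PathConnected L × P L

    -- Along the walk, each vertex not yet in the list is adjacent to its predecessor, which is. By
    -- `unique-neighbour` this is its only edge into the list, so `P-∷` applies.
    include : ∀ {L u v} → Star _~_ u v → u ∈ L → Built L →
              ∃ λ L′ → L ⊆ L′ × v ∈ L′ × Built L′
    include ε u∈L built = _ , (λ p → p) , u∈L , built
    include {L} (_◅_ {j = w} u~w walk) u∈L built@(conn , pL) with w ∈? L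
    ... | yes w∈L = include walk w∈L built
    ... | no w∉L
      with include walk (here refl)
             ( PathConnected-∷ conn u∈L w∉L u~w
             , P-∷ u∈L w∉L u~w (unique-neighbour conn w∉L u∈L u~w) pL)
    ... | L′ , w∷L⊆L′ , v∈L′ , built′ = L′ , w∷L⊆L′ ∘ there , v∈L′ , built′

    includeAll : ∀ {L r} (vs : List V) → (∀ v → Star _~_ r v) → r ∈ L → Built L →
                 ∃ λ L′ → L ⊆ L′ × vs ⊆ L′ × Built L′
    includeAll []       walks r∈L built = _ , (λ p → p) , (λ ()) , built
    includeAll (v ∷ vs) walks r∈L built
      with _  , L⊆L₁  , v∈L₁  , built₁ ← include (walks v) r∈L built
      with L₂ , L₁⊆L₂ , vs⊆L₂ , built₂ ← includeAll vs walks (L⊆L₁ r∈L) built₁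
      = L₂ , L₁⊆L₂ ∘ L⊆L₁ , (λ { (here refl) → L₁⊆L₂ v∈L₁ ; (there p) → vs⊆L₂ p }) , built₂

    tree-induction : Connected → (∀ v → P [ v ]) → ∃ λ L → (∀ v → v ∈ L) × P L
    tree-induction (r , walks) base
      with L , _ , vertices⊆L , _ , pL ←
             includeAll {[ r ]} vertices (walks r) (here refl)
               ( (λ { (here refl) (here refl) p≢q → contradiction refl p≢q }) , base r)
      = L , (λ v → vertices⊆L (∈-vertices v)) , pL

module Tree (T : Graph) (isTree : Graph.IsTree T) where
  open Graph T
  open GraphProperties T
  open Acyclic T (proj₂ isTree)
  open DecMembership _≟ⱽ_ using (_∈?_)

  module _ (Σ : Signature T) where
    open Signature Σ

    -- As signs are their own inverses, the equation says σ(uv) = τ(u) τ(v): the signature is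
    -- balanced on the subgraph induced by `L`.
    Switching : List V → Set
    Switching L = ∃ λ (τ : V → Sign) →
      ∀ {u v} → u ∈ L → v ∈ L → (e : u ~ v) → τ u ≡ σ e Sign.* τ v

    private
      flip : ∀ a {b c} → b ≡ a Sign.* c → c ≡ a Sign.* b
      flip a {c = c} refl = begin
        c                       ≡⟨ cong (Sign._* c) (Sign.s*s≡+ a) ⟨
        (a Sign.* a) Sign.* c   ≡⟨ Sign.*-assoc a a c ⟩
        a Sign.* (a Sign.* c)   ∎
        where open ≡-Reasoning

    -- The edge from p determines the value at w, and w has no other edge into `L` that could
    -- contradict it.
    Switching-∷ : ∀ {L p w} → p ∈ L → w ∉ L → p ~ w →
                  (∀ {q} → q ∈ L → q ~ w → q ≡ p) → Switching L → Switching (w ∷ L)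
    Switching-∷ {L} {p} {w} p∈L w∉L p~w only (τ , valid) = τ′ , valid′
      where
      τ′ : V → Sign
      τ′ x with x ≟ⱽ w
      ... | yes _ = σ p~w Sign.* τ p
      ... | no _  = τ x

      τ′-new : τ′ w ≡ σ p~w Sign.* τ p
      τ′-new with w ≟ⱽ w
      ... | yes _  = refl
      ... | no w≢w = contradiction refl w≢w

      τ′-old : ∀ {x} → x ∈ L → τ′ x ≡ τ x
      τ′-old {x} x∈L with x ≟ⱽ w
      ... | yes refl = contradiction x∈L w∉L
      ... | no _     = refl

      to-new : ∀ {q} → q ∈ L → (e : q ~ w) → τ′ w ≡ σ e Sign.* τ′ q
      to-new q∈L e with only q∈L e
      ... | refl = trans τ′-new (cong₂ (λ d → σ d Sign.*_) (~-irrelevant p~w e) (sym (τ′-old q∈L)))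

      valid′ : ∀ {u v} → u ∈ w ∷ L → v ∈ w ∷ L → (e : u ~ v) → τ′ u ≡ σ e Sign.* τ′ v
      valid′ (here refl) (here refl) e = contradiction e ~-irrefl
      valid′ {v = v} (here refl) (there v∈L) e =
        trans (to-new v∈L (~-sym e)) (cong (Sign._* τ′ v) (σ-sym e))
      valid′ (there u∈L) (here refl) e = flip (σ e) (to-new u∈L e)
      valid′ (there u∈L) (there v∈L) e =
        trans (τ′-old u∈L) (trans (valid u∈L v∈L e) (cong (σ e Sign.*_) (sym (τ′-old v∈L))))

    switching : ∃ λ (τ : V → Sign) → ∀ {u v} (e : u ~ v) → τ u ≡ σ e Sign.* τ v
    switching
      with L , all∈L , τ , valid ← tree-induction Switching Switching-∷ (proj₁ isTree)
             (λ v → (λ _ → Sign.+) , λ { (here refl) (here refl) e → contradiction e ~-irrefl })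
      = τ , λ e → valid (all∈L _) (all∈L _) e

  -- `colour` is total on pairs of vertices but constrained only on edges inside `L`. The number of
  -- colours is the maximum degree of the whole tree from the start.
  record EdgeColours (L : List V) : Set where
    field
      colour     : V → V → ℕ
      colour-sym : ∀ u v → colour u v ≡ colour v u
      colour<    : ∀ {u v} → u ∈ L → v ∈ L → u ~ v → colour u v < maxDegree
      colour-inj : ∀ {u v w} → u ∈ L → v ∈ L → w ∈ L → u ~ v → u ~ w →
                   colour u v ≡ colour u w → v ≡ w

  -- Since w is a neighbour of p outside `L`, fewer than deg p colours occur at p, which leaves one
  -- for the edge pw. At w no conflict can arise, as pw is the only edge there.
  EdgeColours-∷ : ∀ {L p w} → p ∈ L → w ∉ L → p ~ w →
                  (∀ {q} → q ∈ L → q ~ w → q ≡ p) → EdgeColours L → EdgeColours (w ∷ L)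
  EdgeColours-∷ {L} {p} {w} p∈L w∉L p~w only χ = record
    { colour = colour′ ; colour-sym = sym′ ; colour< = bound ; colour-inj = inj }
    where
    open EdgeColours χ

    oldNeighbours : List V
    oldNeighbours = filter (_∈? L) (neighbours p)

    oldNeighbours<maxDegree : length (map (colour p) oldNeighbours) < maxDegree
    oldNeighbours<maxDegree = begin-strict
      length (map (colour p) oldNeighbours)  ≡⟨ length-map (colour p) oldNeighbours ⟩
      length oldNeighbours                   <⟨ filter-notAll (_∈? L) (neighbours p)
                                                  (Any.map (λ { refl → w∉L }) (∈-neighbours⁺ p~w)) ⟩
      degree p                               ≤⟨ degree≤maxDegree p ⟩
      maxDegree                              ∎
      where open ≤-Reasoning

    new : ∃ λ c → c < maxDegree × c ∉ map (colour p) oldNeighbours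
    new = fresh maxDegree _ oldNeighbours<maxDegree

    c₀ : ℕ
    c₀ = proj₁ new

    -- Every pair containing w receives `c₀`; among these pairs only that of p and w is an edge
    -- inside the enlarged list.
    colour′ : V → V → ℕ
    colour′ x y with x ≟ⱽ w | y ≟ⱽ w
    ... | yes _ | _     = c₀
    ... | no _  | yes _ = c₀
    ... | no _  | no _  = colour x y

    sym′ : ∀ u v → colour′ u v ≡ colour′ v u
    sym′ u v with u ≟ⱽ w | v ≟ⱽ w
    ... | yes _ | yes _ = refl
    ... | yes _ | no _  = refl
    ... | no _  | yes _ = refl
    ... | no _  | no _  = colour-sym u v

    newˡ : ∀ v → colour′ w v ≡ c₀
    newˡ v with w ≟ⱽ w
    ... | yes _  = refl
    ... | no w≢w = contradiction refl w≢w

    newʳ : ∀ u → colour′ u w ≡ c₀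
    newʳ u = trans (sym′ u w) (newˡ u)

    old : ∀ {u v} → u ∈ L → v ∈ L → colour′ u v ≡ colour u v
    old {u} {v} u∈L v∈L with u ≟ⱽ w | v ≟ⱽ w
    ... | yes refl | _        = contradiction u∈L w∉L
    ... | no _     | yes refl = contradiction v∈L w∉L
    ... | no _     | no _     = refl

    bound : ∀ {u v} → u ∈ w ∷ L → v ∈ w ∷ L → u ~ v → colour′ u v < maxDegree
    bound {v = v} (here refl) _ _ = subst (_< maxDegree) (sym (newˡ v)) (proj₁ (proj₂ new))
    bound {u} _ (here refl) _ = subst (_< maxDegree) (sym (newʳ u)) (proj₁ (proj₂ new))
    bound (there u∈L) (there v∈L) e =
      subst (_< maxDegree) (sym (old u∈L v∈L)) (colour< u∈L v∈L e)

    new≢old : ∀ {u v} → u ∈ L → v ∈ L → u ~ w → u ~ v → colour′ u w ≢ colour′ u v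
    new≢old {u} {v} u∈L v∈L u~w u~v eq with only u∈L u~w
    ... | refl = proj₂ (proj₂ new) (subst (_∈ map (colour p) oldNeighbours)
                   (trans (sym (old u∈L v∈L)) (trans (sym eq) (newʳ u)))
                   (∈-map⁺ (colour p) (∈-filter⁺ (_∈? L) (∈-neighbours⁺ u~v) v∈L)))

    inj : ∀ {u v x} → u ∈ w ∷ L → v ∈ w ∷ L → x ∈ w ∷ L → u ~ v → u ~ x →
          colour′ u v ≡ colour′ u x → v ≡ x
    inj (here refl) (here refl) _           d _ _ = contradiction d ~-irrefl
    inj (here refl) _           (here refl) _ e _ = contradiction e ~-irrefl
    inj (here refl) (there v∈L) (there x∈L) d e _ =
      trans (only v∈L (~-sym d)) (sym (only x∈L (~-sym e)))
    inj (there u∈L) (here refl) (here refl) _ _ _ = refl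
    inj (there u∈L) (here refl) (there x∈L) d e eq = contradiction eq (new≢old u∈L x∈L d e)
    inj (there u∈L) (there v∈L) (here refl) d e eq = contradiction (sym eq) (new≢old u∈L v∈L e d)
    inj (there u∈L) (there v∈L) (there x∈L) d e eq =
      colour-inj u∈L v∈L x∈L d e (trans (sym (old u∈L v∈L)) (trans eq (old u∈L x∈L)))

  edgeColours : ∃ λ L → (∀ v → v ∈ L) × EdgeColours L
  edgeColours = tree-induction EdgeColours EdgeColours-∷ (proj₁ isTree) (λ v → record
    -- A single vertex spans no edge, so 0 is harmless even when the maximum degree is 0.
    { colour     = λ _ _ → 0
    ; colour-sym = λ _ _ → refl
    ; colour<    = λ { (here refl) (here refl) e → contradiction e ~-irrefl }
    ; colour-inj = λ { (here refl) (here refl) _ e _ _ → contradiction e ~-irrefl }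
    })

-- Colour sets and product colourings

halve : ∀ n → (∃ λ m → n ≡ 2 * m) ⊎ (∃ λ m → n ≡ 2 * m + 1)
halve zero = inj₁ (0 , refl)
halve (suc n) with halve n
... | inj₁ (m , refl) = inj₂ (m , +-comm 1 (2 * m))
... | inj₂ (m , refl) = inj₁ (suc m , arith m)
  where
  arith : ∀ m → suc (2 * m + 1) ≡ 2 * suc m
  arith = solve-∀

even≢2n+1 : ∀ m n → 2 * m ≢ 2 * n + 1
even≢2n+1 m n eq = even≢odd m n (trans eq (+-comm (2 * n) 1))

2m≤1+2n⇒m≤n : ∀ m n → 2 * m ≤ suc (2 * n) → m ≤ n
2m≤1+2n⇒m≤n m n le = ≤-pred (*-cancelˡ-< 2 m (suc n) (≤-trans (s≤s le) (≤-reflexive (sym (*-suc 2 n)))))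

-- Position in the enumeration 0, -1, 1, -2, 2, ..., in which the integers of absolute value at most
-- l are the first 2l + 1.
code : ℤ → ℕ
code (+ n)    = 2 * n
code -[1+ n ] = suc (2 * n)

code-injective : ∀ x y → code x ≡ code y → x ≡ y
code-injective (+ m)    (+ n)    eq = cong +_ (*-cancelˡ-≡ m n 2 eq)
code-injective (+ m)    -[1+ n ] eq = contradiction eq (even≢odd m n)
code-injective -[1+ m ] (+ n)    eq = contradiction (sym eq) (even≢odd n m)
code-injective -[1+ m ] -[1+ n ] eq = cong -[1+_] (*-cancelˡ-≡ m n 2 (suc-injective eq))

code≤2∣x∣ : ∀ x → code x ≤ 2 * ∣ x ∣
code≤2∣x∣ (+ n)    = ≤-refl
code≤2∣x∣ -[1+ n ] = ≤-trans (n≤1+n _) (≤-reflexive (sym (*-suc 2 n)))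

decode : ℕ → ℤ
decode n = [ (λ (m , _) → + m) , (λ (m , _) → -[1+ m ]) ]′ (halve n)

code-decode : ∀ n → code (decode n) ≡ n
code-decode n with halve n
... | inj₁ (m , eq) = sym eq
... | inj₂ (m , eq) = trans (+-comm 1 (2 * m)) (sym eq)

decode-injective : ∀ {m n} → decode m ≡ decode n → m ≡ n
decode-injective {m} {n} eq = trans (sym (code-decode m)) (trans (cong code eq) (code-decode n))

2∣decode∣≤1+n : ∀ n → 2 * ∣ decode n ∣ ≤ suc n
2∣decode∣≤1+n n with halve n
... | inj₁ (m , refl) = n≤1+n _
... | inj₂ (m , refl) = ≤-reflexive (arith m)
  where
  arith : ∀ m → 2 * suc m ≡ suc (2 * m + 1)
  arith = solve-∀

-- For even k the value 0 is missing and the codes start at 1; `pred` closes this gap, so that all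
-- ranks stay below k.
rank : ∀ {k c} → M k c → ℕ
rank {c = c} (odd _ _ _)    = code c
rank {c = c} (even _ _ _ _) = pred (code c)

code-nonZero : ∀ {x} → x ≢ 0ℤ → NonZero (code x)
code-nonZero {x} x≢0 = ≢-nonZero λ eq → x≢0 (code-injective x 0ℤ eq)

rank< : ∀ {k c} (m : M k c) → rank m < k
rank< {c = c} (odd l refl c≤l) = begin-strict
  code c     ≤⟨ code≤2∣x∣ c ⟩
  2 * ∣ c ∣  ≤⟨ *-monoʳ-≤ 2 c≤l ⟩
  2 * l      <⟨ n<1+n _ ⟩
  1 + 2 * l  ≡⟨ +-comm 1 (2 * l) ⟩
  2 * l + 1  ∎
  where open ≤-Reasoning
rank< {c = c} (even l refl c≤l c≢0) = begin-strict
  pred (code c)        <⟨ n<1+n _ ⟩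
  suc (pred (code c))  ≡⟨ suc-pred (code c) {{code-nonZero c≢0}} ⟩
  code c               ≤⟨ code≤2∣x∣ c ⟩
  2 * ∣ c ∣            ≤⟨ *-monoʳ-≤ 2 c≤l ⟩
  2 * l                ∎
  where open ≤-Reasoning

rank-injective : ∀ {k c c′} (m : M k c) (m′ : M k c′) → rank m ≡ rank m′ → c ≡ c′
rank-injective {c = c} {c′} (odd _ _ _) (odd _ _ _) eq = code-injective c c′ eq
rank-injective (odd l refl _) (even l′ eq _ _) _ = contradiction (sym eq) (even≢2n+1 l′ l)
rank-injective (even l refl _ _) (odd l′ eq _) _ = contradiction eq (even≢2n+1 l l′)
rank-injective {c = c} {c′} (even _ _ _ c≢0) (even _ _ _ c′≢0) eq = code-injective c c′ (begin
  code c                ≡⟨ suc-pred (code c) {{code-nonZero c≢0}} ⟨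
  suc (pred (code c))   ≡⟨ cong suc eq ⟩
  suc (pred (code c′))  ≡⟨ suc-pred (code c′) {{code-nonZero c′≢0}} ⟩
  code c′               ∎)
  where open ≡-Reasoning

-- The first k terms of the enumeration 0, -1, 1, ... for odd k; for even k the enumeration starts
-- just after 0.
palette : ∀ k → ∃ λ (h : ℕ → ℤ) → (∀ {n} → n < k → M k (h n)) × (∀ {m n} → h m ≡ h n → m ≡ n)
palette k with halve k
... | inj₂ (l , refl) = decode , in-M , decode-injective
  where
  in-M : ∀ {n} → n < 2 * l + 1 → M (2 * l + 1) (decode n)
  in-M {n} n<k = odd l refl (2m≤1+2n⇒m≤n ∣ decode n ∣ l
    (≤-trans (2∣decode∣≤1+n n) (≤-trans n<k (≤-reflexive (+-comm (2 * l) 1)))))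
... | inj₁ (l , refl) = decode ∘ suc , in-M , suc-injective ∘ decode-injective
  where
  in-M : ∀ {n} → n < 2 * l → M (2 * l) (decode (suc n))
  in-M {n} n<k = even l refl
    (2m≤1+2n⇒m≤n ∣ decode (suc n) ∣ l (≤-trans (2∣decode∣≤1+n (suc n)) (s≤s n<k)))
    (λ eq → 1+n≢0 (trans (sym (code-decode (suc n))) (cong code eq)))

M-bound : ∀ {k c} → M k c → 2 * ∣ c ∣ ≤ k
M-bound (odd l refl c≤l)    = ≤-trans (*-monoʳ-≤ 2 c≤l) (m≤m+n (2 * l) 1)
M-bound (even l refl c≤l _) = *-monoʳ-≤ 2 c≤l

-- The parity of k matters only for 0: if k = 2l + 1, the even number 2|c| is at most k only if it
-- is at most 2l.
M-nonzero⁺ : ∀ k {c} → 2 * ∣ c ∣ ≤ k → c ≢ 0ℤ → M k c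
M-nonzero⁺ k {c} bound c≢0 with halve k
... | inj₁ (l , refl) = even l refl (*-cancelˡ-≤ 2 bound) c≢0
... | inj₂ (l , refl) = odd l refl (2m≤1+2n⇒m≤n ∣ c ∣ l (≤-trans bound (≤-reflexive (+-comm (2 * l) 1))))

M-zero⇒odd : ∀ {k} → M k 0ℤ → ∃ λ l → k ≡ 2 * l + 1
M-zero⇒odd (odd l eq _)     = l , eq
M-zero⇒odd (even _ _ _ 0≢0) = contradiction refl 0≢0

M-∣∣ : ∀ {k x y} → ∣ x ∣ ≡ ∣ y ∣ → M k x → M k y
M-∣∣ eq (odd l k≡ x≤l)      = odd l k≡ (subst (_≤ l) eq x≤l)
M-∣∣ eq (even l k≡ x≤l x≢0) = even l k≡ (subst (_≤ l) eq x≤l)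
  λ { refl → x≢0 (ℤ.∣i∣≡0⇒i≡0 eq) }

2⌊n/2⌋≤n : ∀ n → 2 * ⌊ n /2⌋ ≤ n
2⌊n/2⌋≤n n = begin
  2 * ⌊ n /2⌋          ≡⟨ cong (λ m → ⌊ n /2⌋ + m) (+-identityʳ ⌊ n /2⌋) ⟩
  ⌊ n /2⌋ + ⌊ n /2⌋    ≤⟨ +-monoʳ-≤ ⌊ n /2⌋ (⌊n/2⌋≤⌈n/2⌉ n) ⟩
  ⌊ n /2⌋ + ⌈ n /2⌉    ≡⟨ ⌊n/2⌋+⌈n/2⌉≡n n ⟩
  n                    ∎
  where open ≤-Reasoning

2m≤n⇒m≤⌊n/2⌋ : ∀ m {n} → 2 * m ≤ n → m ≤ ⌊ n /2⌋
2m≤n⇒m≤⌊n/2⌋ m {n} le = begin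
  m               ≡⟨ n≡⌊n+n/2⌋ m ⟩
  ⌊ m + m /2⌋     ≡⟨ cong (λ p → ⌊ m + p /2⌋) (+-identityʳ m) ⟨
  ⌊ 2 * m /2⌋     ≤⟨ ⌊n/2⌋-mono le ⟩
  ⌊ n /2⌋         ∎
  where open ≤-Reasoning

-- Uniqueness of quotient and remainder in division by D.
*+-injective : ∀ {a a′ c c′ D} → c < D → c′ < D → a * D + c ≡ a′ * D + c′ → a ≡ a′ × c ≡ c′
*+-injective {a} {a′} {c} {c′} {D@(suc _)} c<D c′<D eq =
  *-cancelʳ-≡ a a′ D (+-cancelʳ-≡ c (a * D) (a′ * D) (trans eq (cong (λ d → a′ * D + d) (sym c≡c′)))) , c≡c′
  where
  remainder : ∀ b {d} → d < D → (b * D + d) % D ≡ d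
  remainder b {d} d<D = trans (cong (_% D) (+-comm (b * D) d))
                              (trans ([m+kn]%n≡m%n d b D) (m<n⇒m%n≡m d<D))
  c≡c′ : c ≡ c′
  c≡c′ = trans (sym (remainder a c<D)) (trans (cong (_% D) eq) (remainder a′ c′<D))

-- The incidences at a vertex have distinct colours in `M j`, and `rank` embeds `M j` into `Fin j`.
lower-bound : ∀ S {j} → EdgeColoring S j → Δ S ≤ j
lower-bound S {j} χ = maxDegree≤ λ v → injection⇒length≤ (neighbours-unique v)
  (λ p → fromℕ< (rank< (f∈M (∈-neighbours⁻ p))))
  λ {x} {y} p q eq → case x ≟ⱽ y of λ where
    (yes x≡y) → x≡y
    (no x≢y)  → contradiction
      (rank-injective (f∈M (∈-neighbours⁻ p)) (f∈M (∈-neighbours⁻ q)) (fromℕ<-injective _ _ _ _ eq))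
      (proper (∈-neighbours⁻ p) (∈-neighbours⁻ q) x≢y)
  where
  open EdgeColoring χ
  open GraphProperties (SignedGraph.graph S)

-- Signs acting on integers, and the colour of a product edge.

infixr 7 _⊳_
_⊳_ : Sign → ℤ → ℤ
Sign.+ ⊳ x = x
Sign.- ⊳ x = ℤ.- x

◃1* : ∀ s x → (s ◃ 1) ℤ.* x ≡ s ⊳ x
◃1* Sign.+ x = ℤ.*-identityˡ x
◃1* Sign.- x = ℤ.-1*i≡-i x

⊳-⊳ : ∀ s t x → s ⊳ t ⊳ x ≡ (s Sign.* t) ⊳ x
⊳-⊳ Sign.+ t      x = refl
⊳-⊳ Sign.- Sign.+ x = refl
⊳-⊳ Sign.- Sign.- x = ℤ.neg-involutive x

∣⊳∣ : ∀ s x → ∣ s ⊳ x ∣ ≡ ∣ x ∣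
∣⊳∣ Sign.+ x = refl
∣⊳∣ Sign.- x = ℤ.∣-i∣≡∣i∣ x

⊳-injective : ∀ s {x y} → s ⊳ x ≡ s ⊳ y → x ≡ y
⊳-injective Sign.+ eq = eq
⊳-injective Sign.- eq = ℤ.neg-injective eq

⊳-positive-injective : ∀ s t {m n} → s ⊳ +[1+ m ] ≡ t ⊳ +[1+ n ] → s ≡ t × m ≡ n
⊳-positive-injective Sign.+ Sign.+ refl = refl , refl
⊳-positive-injective Sign.- Sign.- refl = refl , refl

module Mix (k D : ℕ) where

  h : ℕ → ℤ
  h = proj₁ (palette D)

  h∈M : ∀ {n} → n < D → M D (h n)
  h∈M = proj₁ (proj₂ (palette D))

  h-injective : ∀ {m n} → h m ≡ h n → m ≡ n
  h-injective = proj₂ (proj₂ (palette D))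

  -- The absolute values up to the offset are kept for the edges of colour 0
  -- in the first factor, which exist only for odd k.
  offset : ℕ
  offset = [ (λ _ → 0) , (λ _ → ⌊ D /2⌋) ]′ (halve k)

  -- The absolute value a + 1 in the first factor owns the D absolute values that follow aD +
  -- `offset`, one for each tree colour.
  block : ℕ → ℕ → ℕ
  block a n = (a * D + n) + offset

  -- At a vertex (u , u′), x is the colour and t the sign of an edge at u, n is
  -- the colour of an edge at u′, and θ a is the value at u′ of a function
  -- switching the signature a σ₂.
  tone : ℕ → ℕ → ℤ
  tone zero    n = h n
  tone (suc a) n = +[1+ block a n ]

  hue : Sign → (Sign → Sign) → ℤ → Sign
  hue t θ +0       = θ (opposite t)
  hue t θ +[1+ _ ] = θ Sign.+
  hue t θ -[1+ _ ] = opposite (θ Sign.+)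

  mix : Sign → (Sign → Sign) → ℤ → ℕ → ℤ
  mix t θ x n = hue t θ x ⊳ tone ∣ x ∣ n

  -- Colour 0 forces k to be odd, so the offset is ⌊D/2⌋, which bounds the absolute values in `M D`.
  h≤offset : M k 0ℤ → ∀ {n} → n < D → ∣ h n ∣ ≤ offset
  h≤offset 0∈M {n} n<D with halve k | M-zero⇒odd 0∈M
  ... | inj₁ (m , refl) | l , eq = contradiction eq (even≢2n+1 m l)
  ... | inj₂ _          | _      = 2m≤n⇒m≤⌊n/2⌋ ∣ h n ∣ (M-bound (h∈M n<D))

  -- For k = 2l the blocks end at most at lD. For k = 2l + 1 they end at most at lD + ⌊D/2⌋, and
  -- twice this is at most 2lD + D = kD.
  2block≤ : ∀ {a n} → 2 * suc a ≤ k → n < D → 2 * suc (block a n) ≤ k * D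
  2block≤ {a} {n} bound n<D with halve k
  ... | inj₁ (l , refl) = begin
    2 * suc (a * D + n + 0)  ≡⟨ arith (a * D) n ⟩
    2 * (suc n + a * D)      ≤⟨ *-monoʳ-≤ 2 (+-monoˡ-≤ (a * D) n<D) ⟩
    2 * (suc a * D)          ≡⟨ *-assoc 2 (suc a) D ⟨
    2 * suc a * D            ≤⟨ *-monoˡ-≤ D bound ⟩
    2 * l * D                ∎
    where
    open ≤-Reasoning
    arith : ∀ x n → 2 * suc (x + n + 0) ≡ 2 * (suc n + x)
    arith = solve-∀
  ... | inj₂ (l , refl) = begin
    2 * suc (a * D + n + ⌊ D /2⌋)        ≡⟨ arith (a * D) n ⌊ D /2⌋ ⟩
    2 * (suc n + a * D) + 2 * ⌊ D /2⌋    ≤⟨ +-mono-≤ (*-monoʳ-≤ 2 (+-monoˡ-≤ (a * D) n<D)) (2⌊n/2⌋≤n D) ⟩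
    2 * (suc a * D) + D                  ≤⟨ +-monoˡ-≤ D (*-monoʳ-≤ 2 (*-monoˡ-≤ D 1+a≤l)) ⟩
    2 * (l * D) + D                      ≡⟨ arith′ l D ⟩
    (2 * l + 1) * D                      ∎
    where
    open ≤-Reasoning
    1+a≤l : suc a ≤ l
    1+a≤l = 2m≤1+2n⇒m≤n (suc a) l (≤-trans bound (≤-reflexive (+-comm (2 * l) 1)))
    arith : ∀ x n b → 2 * suc (x + n + b) ≡ 2 * (suc n + x) + 2 * b
    arith = solve-∀
    arith′ : ∀ l D → 2 * (l * D) + D ≡ (2 * l + 1) * D
    arith′ = solve-∀

  -- Here k is odd, hence positive, so a nonzero y meets the weaker bound. If y = 0, then D is odd
  -- as well, and so is kD.
  M-product : M k 0ℤ → ∀ {y} → M D y → M (k * D) y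
  M-product 0∈M {y} y∈M with M-zero⇒odd 0∈M | y ℤ.≟ 0ℤ
  ... | l , refl | no y≢0 = M-nonzero⁺ (k * D)
    (≤-trans (M-bound y∈M) (m≤n*m D k {{subst NonZero (+-comm 1 (2 * l)) _}})) y≢0
  ... | l , refl | yes refl with M-zero⇒odd y∈M
  ...   | m , refl = odd (l * (2 * m + 1) + m) (arith l m) z≤n
    where
    arith : ∀ l m → (2 * l + 1) * (2 * m + 1) ≡ 2 * (l * (2 * m + 1) + m) + 1
    arith = solve-∀

  tone∈M : ∀ x {n} → M k x → n < D → M (k * D) (tone ∣ x ∣ n)
  tone∈M +0       x∈M n<D = M-product x∈M (h∈M n<D)
  tone∈M +[1+ a ] x∈M n<D = M-nonzero⁺ (k * D) (2block≤ (M-bound x∈M) n<D) λ ()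
  tone∈M -[1+ a ] x∈M n<D = M-nonzero⁺ (k * D) (2block≤ (M-bound x∈M) n<D) λ ()

  mix∈M : ∀ t θ x {n} → M k x → n < D → M (k * D) (mix t θ x n)
  mix∈M t θ x x∈M n<D = M-∣∣ (sym (∣⊳∣ (hue t θ x) _)) (tone∈M x x∈M n<D)

  zero≢block : ∀ s t {n c} → M k 0ℤ → n < D → offset ≤ c → s ⊳ h n ≢ t ⊳ +[1+ c ]
  zero≢block s t {n} 0∈M n<D offset≤c eq = <⇒≢
    (s≤s (≤-trans (h≤offset 0∈M n<D) offset≤c))
    (trans (sym (∣⊳∣ s (h n))) (trans (cong ∣_∣ eq) (∣⊳∣ t _)))

  block-injective : ∀ {a b m n} → m < D → n < D → block a m ≡ block b n → a ≡ b × m ≡ n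
  block-injective m<D n<D eq = *+-injective m<D n<D (+-cancelʳ-≡ offset _ _ eq)

  -- The absolute value tells zero from nonzero x and, for nonzero x, gives |x| and n; the sign of x
  -- follows because `θ` is shared. For x = 0 the hue depends on t and `h` can take opposite values,
  -- so n is recovered only when t = t′.
  mix-injective : ∀ {t t′ θ x x′ n n′} → M k x → M k x′ → n < D → n′ < D →
                  mix t θ x n ≡ mix t′ θ x′ n′ → x ≡ x′ × (t ≡ t′ → n ≡ n′)
  mix-injective {t} {θ = θ} {+0} {+0} _ _ _ _ eq =
    refl , λ { refl → h-injective (⊳-injective (θ (opposite t)) eq) }
  mix-injective {t} {θ = θ} {+0} {+[1+ _ ]} 0∈M _ n<D _ eq =
    contradiction eq (zero≢block (θ (opposite t)) (θ Sign.+) 0∈M n<D (m≤n+m offset _))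
  mix-injective {t} {θ = θ} {+0} { -[1+ _ ]} 0∈M _ n<D _ eq =
    contradiction eq (zero≢block (θ (opposite t)) (opposite (θ Sign.+)) 0∈M n<D (m≤n+m offset _))
  mix-injective {t′ = t′} {θ = θ} {+[1+ _ ]} {+0} _ 0∈M _ n<D eq =
    contradiction (sym eq) (zero≢block (θ (opposite t′)) (θ Sign.+) 0∈M n<D (m≤n+m offset _))
  mix-injective {t′ = t′} {θ = θ} { -[1+ _ ]} {+0} _ 0∈M _ n<D eq =
    contradiction (sym eq) (zero≢block (θ (opposite t′)) (opposite (θ Sign.+)) 0∈M n<D (m≤n+m offset _))
  mix-injective {θ = θ} {+[1+ a ]} {+[1+ b ]} _ _ n<D n′<D eq
    with refl , refl ← block-injective {a} {b} n<D n′<D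
                         (proj₂ (⊳-positive-injective (θ Sign.+) (θ Sign.+) eq))
    = refl , λ _ → refl
  mix-injective {θ = θ} { -[1+ a ]} { -[1+ b ]} _ _ n<D n′<D eq
    with refl , refl ← block-injective {a} {b} n<D n′<D
                         (proj₂ (⊳-positive-injective (opposite (θ Sign.+)) (opposite (θ Sign.+)) eq))
    = refl , λ _ → refl
  mix-injective {θ = θ} {+[1+ _ ]} { -[1+ _ ]} _ _ _ _ eq = contradiction
    (proj₁ (⊳-positive-injective (θ Sign.+) (opposite (θ Sign.+)) eq)) (Sign.s≢opposite[s] _)
  mix-injective {θ = θ} { -[1+ _ ]} {+[1+ _ ]} _ _ _ _ eq = contradiction
    (sym (proj₁ (⊳-positive-injective (opposite (θ Sign.+)) (θ Sign.+) eq))) (Sign.s≢opposite[s] _)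

  -- The product edge demands the factor -ts. For nonzero x, passing from x to -tx contributes -t
  -- and `θ Sign.+` contributes s. For x = 0 negation does nothing, and `θ (opposite t)` contributes
  -- all of -ts.
  hue-signed : ∀ t s {θ θ′} → (∀ a → θ a ≡ (a Sign.* s) Sign.* θ′ a) → ∀ x →
               hue t θ (ℤ.- (t ⊳ x)) ≡ opposite (t Sign.* s) Sign.* hue t θ′ x
  hue-signed Sign.+ s θ≡ +0       = θ≡ Sign.-
  hue-signed Sign.- s θ≡ +0       = trans (θ≡ Sign.+) (cong (Sign._* _) (sym (Sign.opposite-involutive s)))
  hue-signed Sign.+ s θ≡ +[1+ _ ] = trans (cong opposite (θ≡ Sign.+)) (sym (Sign.*-assoc Sign.- s _))
  hue-signed Sign.- s θ≡ +[1+ _ ] = trans (θ≡ Sign.+) (cong (Sign._* _) (sym (Sign.opposite-involutive s)))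
  hue-signed Sign.+ s {θ′ = θ′} θ≡ -[1+ _ ] = trans (θ≡ Sign.+) (opposite-both s (θ′ Sign.+))
    where
    opposite-both : ∀ a b → a Sign.* b ≡ opposite a Sign.* opposite b
    opposite-both Sign.+ b = sym (Sign.opposite-involutive b)
    opposite-both Sign.- b = refl
  hue-signed Sign.- s {θ′ = θ′} θ≡ -[1+ _ ] = trans (cong opposite (θ≡ Sign.+)) (opposite-thrice s (θ′ Sign.+))
    where
    opposite-thrice : ∀ a b → opposite (a Sign.* b) ≡ opposite (opposite a) Sign.* opposite b
    opposite-thrice Sign.+ b = refl
    opposite-thrice Sign.- b = refl

  mix-signed : ∀ t s {θ θ′} → (∀ a → θ a ≡ (a Sign.* s) Sign.* θ′ a) → ∀ x n →
               mix t θ (ℤ.- (t ⊳ x)) n ≡ ℤ.- ((t Sign.* s) ⊳ mix t θ′ x n)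
  mix-signed t s {θ} {θ′} θ≡ x n = begin
    mix t θ (ℤ.- (t ⊳ x)) n
      ≡⟨ cong₂ (λ r a → r ⊳ tone a n) (hue-signed t s θ≡ x) (trans (ℤ.∣-i∣≡∣i∣ (t ⊳ x)) (∣⊳∣ t x)) ⟩
    (opposite (t Sign.* s) Sign.* hue t θ′ x) ⊳ tone ∣ x ∣ n
      ≡⟨ ⊳-⊳ (opposite (t Sign.* s)) (hue t θ′ x) _ ⟨
    opposite (t Sign.* s) ⊳ mix t θ′ x n
      ≡⟨ ⊳-⊳ Sign.- (t Sign.* s) _ ⟨
    ℤ.- ((t Sign.* s) ⊳ mix t θ′ x n) ∎
    where open ≡-Reasoning

-- The colouring of the product and its chromatic index.

product-coloring : ∀ T → Graph.IsTree T → (S₁ : SignedGraph) (σ₂ : Signature T) →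
                   ∀ {k} → EdgeColoring S₁ k → EdgeColoring (S₁ ×ˢ (T , σ₂)) (k * Graph.maxDegree T)
product-coloring T isTree S₁ σ₂ {k} χ = record
  { f      = λ { {_ , u′} {_ , v′} (e , _) → mix (S₁.σ e) (θ u′) (f e) (colour u′ v′) }
  ; f∈M    = λ { {_ , u′} {_ , v′} (e , e′) → mix∈M (S₁.σ e) (θ u′) (f e) (f∈M e) (bound e′) }
  ; signed = λ { {_ , u′} {_ , v′} (e , e′) → signed′ e e′ }
  ; proper = λ { (d , d′) (e , e′) → proper′ d d′ e e′ }
  }
  where
  open EdgeColoring χ
  open Mix k (Graph.maxDegree T)
  module S₁ = SignedGraph S₁
  module T = Graph T
  module σ₂ = Signature σ₂
  open GraphProperties S₁.graph using (_≟ⱽ_)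
  open Tree T isTree

  all∈ : ∀ v → v ∈ proj₁ edgeColours
  all∈ = proj₁ (proj₂ edgeColours)

  open EdgeColours (proj₂ (proj₂ edgeColours))

  bound : ∀ {u v} → u T.~ v → colour u v < T.maxDegree
  bound = colour< (all∈ _) (all∈ _)

  twisted : Sign → Signature T
  twisted a = record { σ = λ e → a Sign.* σ₂.σ e ; σ-sym = λ e → cong (a Sign.*_) (σ₂.σ-sym e) }

  -- One switching of the whole tree is fixed for each sign a, so all edges at (u , u′) share the
  -- function `θ u′`, as `mix-injective` requires.
  θ : T.V → Sign → Sign
  θ v a = proj₁ (switching (twisted a)) v

  signed′ : ∀ {u v u′ v′} (e : u S₁.~ v) (e′ : u′ T.~ v′) →
            mix (S₁.σ e) (θ u′) (f e) (colour u′ v′) ≡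
            ℤ.- ((S₁.σ e Sign.* σ₂.σ e′ ◃ 1) ℤ.*
                 mix (S₁.σ (S₁.~-sym e)) (θ v′) (f (S₁.~-sym e)) (colour v′ u′))
  signed′ {u′ = u′} {v′} e e′ = begin
    mix (S₁.σ e) (θ u′) (f e) (colour u′ v′)
      ≡⟨ cong₂ (mix (S₁.σ e) (θ u′)) (trans (signed e) (cong ℤ.-_ (◃1* (S₁.σ e) _))) (colour-sym u′ v′) ⟩
    mix (S₁.σ e) (θ u′) (ℤ.- (S₁.σ e ⊳ x)) n
      ≡⟨ mix-signed (S₁.σ e) (σ₂.σ e′) (λ a → proj₂ (switching (twisted a)) e′) x n ⟩
    ℤ.- ((S₁.σ e Sign.* σ₂.σ e′) ⊳ mix (S₁.σ e) (θ v′) x n)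
      ≡⟨ cong (λ t → ℤ.- ((S₁.σ e Sign.* σ₂.σ e′) ⊳ mix t (θ v′) x n)) (S₁.σ-sym e) ⟨
    ℤ.- ((S₁.σ e Sign.* σ₂.σ e′) ⊳ mix (S₁.σ (S₁.~-sym e)) (θ v′) x n)
      ≡⟨ cong ℤ.-_ (◃1* (S₁.σ e Sign.* σ₂.σ e′) _) ⟨
    ℤ.- ((S₁.σ e Sign.* σ₂.σ e′ ◃ 1) ℤ.* mix (S₁.σ (S₁.~-sym e)) (θ v′) x n) ∎
    where
    open ≡-Reasoning
    x = f (S₁.~-sym e)
    n = colour v′ u′

  -- Equal mixed colours give `f d ≡ f e`, hence v = w. Then d and e coincide and have the same
  -- sign, so the tree colours agree too, and v′ = w′.
  proper′ : ∀ {u v w u′ v′ w′} (d : u S₁.~ v) (d′ : u′ T.~ v′) (e : u S₁.~ w) (e′ : u′ T.~ w′) →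
            (v , v′) ≢ (w , w′) →
            mix (S₁.σ d) (θ u′) (f d) (colour u′ v′) ≢ mix (S₁.σ e) (θ u′) (f e) (colour u′ w′)
  proper′ {v = v} {w} {u′} d d′ e e′ v≢w eq
    with mix-injective {θ = θ u′} (f∈M d) (f∈M e) (bound d′) (bound e′) eq | v ≟ⱽ w
  ... | fd≡fe , _  | no v≢w₁  = proper d e v≢w₁ fd≡fe
  ... | _ , c≡     | yes refl = v≢w (cong (v ,_)
    (colour-inj (all∈ _) (all∈ _) (all∈ _) d′ e′ (c≡ (cong S₁.σ (S₁.~-irrelevant d e)))))

theorem20 : (T : Graph) → Graph.IsTree T →
    (S₁ : SignedGraph) (σ₂ : Signature T) →
    HasChromaticIndex S₁ (Δ S₁) →
    HasChromaticIndex (S₁ ×ˢ (T , σ₂)) (Δ (S₁ ×ˢ (T , σ₂)))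
theorem20 T isTree S₁ σ₂ (χ , _) = subst (EdgeColoring S) Δ≡ ψ , λ _ → lower-bound S
  where
  S : SignedGraph
  S = S₁ ×ˢ (T , σ₂)

  ψ : EdgeColoring S (Δ S₁ * Graph.maxDegree T)
  ψ = product-coloring T isTree S₁ σ₂ χ

  -- The bound of Δ(S) from above is read off the colouring `ψ`, whose number of colours is at least
  -- Δ(S).
  Δ≡ : Δ S₁ * Graph.maxDegree T ≡ Δ S
  Δ≡ = ≤-antisym (maxDegree-×ᴳ (SignedGraph.graph S₁) T) (lower-bound S ψ)
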